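{- Let $c$ be a positive integer. Let $G$ be a CREW PRAM over the integers without bit operations which, on inputs of length $N$, uses $2^{O((\log N)^c)}$ processors. Then $G$ does not decide the maxflow problem in $O((\log N)^c)$ steps.
   Context: A sequential random access machine (SRAM) over $\mathbb{Z}$ is a finite list of numbered commands $1,\dots,L$ acting on integer registers $X_0,X_1,\dots$; each command is one of: skip; $X_i:=c$ ($c\in\mathbb{Z}$); $X_i:=X_j\circ X_k$ with $\circ\in\{+,-,\times\}$; $X_i:=X_j/X_k$ (Euclidean quotient $b$ with $X_j=bX_k+r$, $0\leqslant r<X_k$, when $X_k\neq0$, and $0$ otherwise); $X_i:=X_j$; $X_i:=\sharp X_j$ (indirect read: $X_i$ receives the content of register number $X_j$); $\sharp X_i:=X_j$ (indirect write into register number $X_i$); if $X_i=0$ goto $\ell$ else goto $\ell'$. Non-jump commands proceed to the next line. A PRAM with $p$ processors is a tuple of $p$ SRAMs run synchronously, each with its own private registers and all sharing a common set of registers; it uses the CREW discipline: concurrent reads are allowed, and if several processors write to the shared memory at the same step, only the one of smallest index does so. No other operations (in particular no access to individual bits) are available. An input $(x_1,\dots,x_d)\in\mathbb{Z}^d$ is given in shared memory as $(d,x_1,\dots,x_d,0,\dots)$, all other registers being $0$; the machine accepts by reaching a distinguished accepting control state. A step is one synchronous step of all processors. The length $N$ of an input is the minimal length of a binary word representing it; the number of processors may depend on $N$. The maxflow (decision) problem: given a network (directed or undirected graph with nonnegative integer capacities, a source and a sink) and an integer threshold, all encoded as integers, decide whether the maximum source-to-sink flow value is at least the threshold. -}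

module Defs where

open import Data.Bool using (Bool; true; false; if_then_else_)
open import Data.Nat as ℕ using (ℕ; zero; suc; _≡ᵇ_)
open import Data.Nat.Logarithm using (⌊log₂_⌋)
open import Data.Integer as ℤ using (ℤ; +_; -[1+_]; +[1+_])
open import Data.Integer.DivMod using (_/_)
open import Data.Rational as ℚ using (ℚ)
open import Data.Fin using (Fin; zero; suc; toℕ)
open import Data.List as List using (List; []; _∷_; length; concatMap; map; allFin)
open import Data.Nat.ListAction using (sum)
open import Data.Maybe using (Maybe; just; nothing)
open import Data.Product using (_×_; _,_; Σ; ∃; ∃-syntax)
open import Relation.Nullary using (does; ¬_)
open import Relation.Binary.PropositionalEquality using (_≡_)

data Space : Set where
  priv shared : Space

Reg : Set
Reg = Space × ℕ

data Op : Set where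
  plus minus times quot : Op

data Instr : Set where
  skip   : Instr
  const  : Reg → ℤ → Instr
  arith  : Op → Reg → Reg → Reg → Instr
  copy   : Reg → Reg → Instr
  iread  : Reg → Space → Reg → Instr       -- X_i := ♯X_j  (register number X_j of the given memory)
  iwrite : Space → Reg → Reg → Instr       -- ♯X_i := X_j  (register number X_i of the given memory)
  ifz    : Reg → ℕ → ℕ → Instr

-- An SRAM program: commands numbered 1 … L (the list, 1-based).
Program : Set
Program = List Instr

-- A PRAM with (suc m) processors, processor 0 carrying the
-- distinguished accepting control state (line number) acc.
record PRAM : Set where
  field
    m    : ℕ
    prog : Fin (suc m) → Program
    acc  : ℕ

numProcs : PRAM → ℕ
numProcs G = suc (PRAM.m G)

Mem : Set
Mem = ℤ → ℤ

upd : Mem → ℤ → ℤ → Mem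
upd M a v b = if does (b ℤ.≟ a) then v else M b

-- Euclidean quotient, 0 when the divisor is 0.
equot : ℤ → ℤ → ℤ
equot x (+ zero)   = + zero
equot x +[1+ n ]   = x / +[1+ n ]
equot x -[1+ n ]   = x / -[1+ n ]

evalOp : Op → ℤ → ℤ → ℤ
evalOp plus  = ℤ._+_
evalOp minus = ℤ._-_
evalOp times = ℤ._*_
evalOp quot  = equot

record ProcState : Set where
  constructor ⟨_,_⟩
  field
    pc  : ℕ
    reg : Mem

-- fetch the command on line pc (lines 1 … L); nothing = halted
fetch : Program → ℕ → Maybe Instr
fetch P zero = nothing
fetch [] (suc _) = nothing
fetch (i ∷ P) (suc zero) = just i
fetch (i ∷ P) (suc (suc n)) = fetch P (suc n)

readSp : Space → Mem → Mem → ℤ → ℤ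
readSp priv   R S a = R a
readSp shared R S a = S a

rd : Mem → Mem → Reg → ℤ
rd R S (s , i) = readSp s R S (+ i)

-- result of one processor step: new local state and possibly a
-- write request (address, value) into shared memory
record Action : Set where
  constructor act
  field
    next  : ProcState
    write : Maybe (ℤ × ℤ)

writeSp : Space → ℤ → ℤ → ℕ → Mem → Action
writeSp priv   a v pc' R = act ⟨ pc' , upd R a v ⟩ nothing
writeSp shared a v pc' R = act ⟨ pc' , R ⟩ (just (a , v))

wr : Reg → ℤ → ℕ → Mem → Action
wr (s , i) v = writeSp s (+ i) v

procStep : Program → Mem → ProcState → Action
procStep P S ⟨ pc , R ⟩ with fetch P pc
... | nothing = act ⟨ pc , R ⟩ nothing
... | just skip = act ⟨ suc pc , R ⟩ nothing
... | just (const r c) = wr r c (suc pc) R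
... | just (arith o r r₁ r₂) = wr r (evalOp o (rd R S r₁) (rd R S r₂)) (suc pc) R
... | just (copy r r₁) = wr r (rd R S r₁) (suc pc) R
... | just (iread r s r₁) = wr r (readSp s R S (rd R S r₁)) (suc pc) R
... | just (iwrite s r r₁) = writeSp s (rd R S r) (rd R S r₁) (suc pc) R
... | just (ifz r ℓ ℓ′) = act ⟨ (if does (rd R S r ℤ.≟ + zero) then ℓ else ℓ′) , R ⟩ nothing

-- CREW rule: among all processors requesting a shared write in this
-- step, only the one of smallest index writes.
firstWrite : (n : ℕ) → (Fin n → Action) → Maybe (ℤ × ℤ)
firstWrite zero f = nothing
firstWrite (suc n) f with Action.write (f zero)
... | just w  = just w
... | nothing = firstWrite n (λ i → f (suc i))

record Config (p : ℕ) : Set where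
  constructor cfg
  field
    sharedMem : Mem
    procs     : Fin p → ProcState

step : (G : PRAM) → Config (numProcs G) → Config (numProcs G)
step G (cfg S ps) = cfg S' (λ i → Action.next (as i))
  where
    as : Fin (numProcs G) → Action
    as i = procStep (PRAM.prog G i) S (ps i)
    S' : Mem
    S' with firstWrite (numProcs G) as
    ... | nothing      = S
    ... | just (a , v) = upd S a v

run : (G : PRAM) → ℕ → Config (numProcs G) → Config (numProcs G)
run G zero c = c
run G (suc t) c = run G t (step G c)

inputMem : List ℤ → Mem
inputMem xs (+ zero)    = + length xs
inputMem xs +[1+ i ]    = go xs i
  where
    go : List ℤ → ℕ → ℤ
    go []       _       = + zero
    go (x ∷ _)  zero    = x
    go (_ ∷ ys) (suc j) = go ys j
inputMem xs -[1+ _ ]    = + zero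

initConfig : (G : PRAM) → List ℤ → Config (numProcs G)
initConfig G xs = cfg (inputMem xs) (λ _ → ⟨ 1 , (λ _ → + zero) ⟩)

AcceptsWithin : PRAM → ℕ → List ℤ → Set
AcceptsWithin G T xs =
  ∃[ t ] (t ℕ.≤ T × ProcState.pc (Config.procs (run G t (initConfig G xs)) zero) ≡ PRAM.acc G)

bitLen : ℕ → ℕ
bitLen n = suc ⌊log₂ n ⌋

-- length of a binary word encoding (x₁, …, x_d): each entry by its
-- sign bit and the binary digits of its absolute value, plus a separator
inputLength : List ℤ → ℕ
inputLength xs = sum (map (λ x → 2 ℕ.+ bitLen ℤ.∣ x ∣) xs)

-- A directed network on vertices Fin n with nonnegative integer
-- capacities (capacity 0 = no edge), source s, sink t, threshold k.
record MaxflowInstance : Set where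
  field
    n   : ℕ
    s t : Fin n
    cap : Fin n → Fin n → ℕ
    k   : ℤ

sumℚ : (n : ℕ) → (Fin n → ℚ) → ℚ
sumℚ zero f = ℚ.0ℚ
sumℚ (suc n) f = f zero ℚ.+ sumℚ n (λ i → f (suc i))

module _ (I : MaxflowInstance) where
  open MaxflowInstance I

  inflow : (Fin n → Fin n → ℚ) → Fin n → ℚ
  inflow f v = sumℚ n (λ u → f u v)

  outflow : (Fin n → Fin n → ℚ) → Fin n → ℚ
  outflow f v = sumℚ n (λ w → f v w)

  -- a feasible (real-valued, here rational) source-to-sink flow
  record IsFlow (f : Fin n → Fin n → ℚ) : Set where
    field
      nonneg   : ∀ u v → ℚ.0ℚ ℚ.≤ f u v
      capacity : ∀ u v → f u v ℚ.≤ (+ cap u v) ℚ./ 1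
      conserve : ∀ v → ¬ (v ≡ s) → ¬ (v ≡ t) → inflow f v ≡ outflow f v

  flowValue : (Fin n → Fin n → ℚ) → ℚ
  flowValue f = outflow f s ℚ.- inflow f s

  MaxflowYes : Set
  MaxflowYes = ∃[ f ] (IsFlow f × k ℚ./ 1 ℚ.≤ flowValue f)

encode : MaxflowInstance → List ℤ
encode I = + n ∷ + toℕ s ∷ + toℕ t ∷ k ∷
           concatMap (λ u → map (λ v → + cap u v) (allFin n)) (allFin n)
  where
    open MaxflowInstance I

logPow : ℕ → ℕ → ℕ
logPow c N = ⌊log₂ N ⌋ ℕ.^ c

-- A nonuniform PRAM family (one PRAM for each input length N) uses
-- 2^{O((log N)^c)} processors.
ProcessorBound : ℕ → (ℕ → PRAM) → Set
ProcessorBound c G =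
  ∃[ a ] ∃[ N₀ ] (∀ N → N₀ ℕ.≤ N → numProcs (G N) ℕ.≤ 2 ℕ.^ (a ℕ.* logPow c N))

DecidesMaxflowPolylog : ℕ → (ℕ → PRAM) → Set
DecidesMaxflowPolylog c G =
  ∃[ b ] ∃[ N₁ ] (∀ (I : MaxflowInstance) → N₁ ℕ.≤ inputLength (encode I) →
    let N = inputLength (encode I) in
    (MaxflowYes I → AcceptsWithin (G N) (b ℕ.* logPow c N) (encode I)) ×
    (AcceptsWithin (G N) (b ℕ.* logPow c N) (encode I) → MaxflowYes I))

{-# OPTIONS --safe #-}
-- The CREW rule lets only one processor write per step, so the number of processors
-- is irrelevant. Having fixed some input cells so that the writes before step t are
-- determined, take the least processor i that writes at step t under some input
-- compatible with them, and pass to such an input. Fixing the at most 2 (t + 1) cells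
-- that i has read determines the write of step t, because no smaller processor can
-- write. So T (T + 3) cells determine T writes and the control states of processor 0.
-- In a star network with 2k source edges of capacity 0 or 1 and threshold k, fixing
-- fewer than k of these capacities leaves the answer open, and T (T + 3) is
-- polylogarithmic in the input length, which is O(k²).
module Submission where

open import Defs
open import Data.Bool using (Bool; true; false; if_then_else_; _∨_)
open import Data.Fin using (Fin; zero; suc; toℕ)
open import Data.Fin.Properties using (toℕ-injective; suc-injective)
open import Data.Integer as ℤ using (ℤ; +_; +[1+_]; -[1+_])
import Data.Integer.Properties as ℤ
open import Data.List using (List; []; _∷_; _++_; length; map; concat; tabulate; allFin)
open import Data.List.Membership.DecPropositional ℤ._≟_ using (_∈?_)
open import Data.List.Properties using (length-++; map-++; map-tabulate; tabulate-cong; length-tabulate)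
open import Data.List.Relation.Unary.All as All using (All; []; _∷_)
open import Data.List.Relation.Unary.All.Properties using (++⁻ˡ; ++⁻ʳ)
open import Data.Maybe using (Maybe; just; nothing)
open import Data.Nat as ℕ using (ℕ; zero; suc; _+_; _*_; _^_; _≤_; _<_; z≤n; s≤s; NonZero)
open import Data.Nat.ListAction using () renaming (sum to sumᴸ)
open import Data.Nat.ListAction.Properties using (sum-++)
open import Data.Nat.Logarithm using (⌊log₂_⌋; ⌊log₂⌋-mono-≤; ⌊log₂[2^n]⌋≡n)
open import Data.Nat.Properties hiding (suc-injective; _≟_)
open import Algebra.Properties.CommutativeMonoid.Sum +-0-commutativeMonoid
  using (sum; sum-cong-≗; ∑-distrib-+; sum-replicate-zero)
open import Data.Nat.Tactic.RingSolver using (solve-∀)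
open import Data.Product using (_×_; _,_; ∃; ∃-syntax; proj₁; proj₂)
open import Data.Rational as ℚ using (ℚ; 0ℚ; _/_)
import Data.Rational.Properties as ℚ
import Data.Rational.Unnormalised as ℚᵘ
import Data.Rational.Unnormalised.Properties as ℚᵘ
open import Data.Sum using (_⊎_; inj₁; inj₂)
open import Function using (_∘_)
open import Relation.Binary.PropositionalEquality
open import Relation.Nullary using (¬_; yes; no; does; contradiction)
open import Relation.Nullary.Decidable using (dec-true; dec-false; ¬¬-excluded-middle)
open import Relation.Nullary.Negation using (¬¬-map)

open Config using (sharedMem; procs)
open Action using (next; write)
open ProcState using (pc; reg)

-- Locality of a single processor step

infix 4 _≈ₚ_ _≈ₐ_

-- Memories are functions, so states are compared pointwise and function extensionality is avoided.
record _≈ₚ_ (s s′ : ProcState) : Set where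
  constructor _,_
  field
    pc≡  : pc s ≡ pc s′
    reg≗ : reg s ≗ reg s′

record _≈ₐ_ (a a′ : Action) : Set where
  constructor _,_
  field
    next≈  : next a ≈ₚ next a′
    write≡ : write a ≡ write a′

-- The (at most two) shared addresses on which the effect of a command depends,
-- padded with address 0 and with addresses that are only read privately.
touched : Maybe Instr → Mem → Mem → ℤ × ℤ
touched (just (arith _ _ (_ , i) (_ , j))) R S = + i , + j
touched (just (copy _ (_ , i)))            R S = + i , + 0
touched (just (iread _ _ r@(_ , i)))       R S = + i , rd R S r
touched (just (iwrite _ (_ , i) (_ , j)))  R S = + i , + j
touched (just (ifz (_ , i) _ _))           R S = + i , + 0
touched _                                  R S = + 0 , + 0

readSp-cong : ∀ s {R R′ S S′ a} → R ≗ R′ → S a ≡ S′ a → readSp s R S a ≡ readSp s R′ S′ a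
readSp-cong priv   R≗ S≡ = R≗ _
readSp-cong shared R≗ S≡ = S≡

upd-cong : ∀ (M M′ : Mem) a v {b} → M b ≡ M′ b → upd M a v b ≡ upd M′ a v b
upd-cong M M′ a v {b} eq with does (b ℤ.≟ a)
... | true  = refl
... | false = eq

writeSp-cong : ∀ s {a a′ v v′} ℓ {R R′} → a ≡ a′ → v ≡ v′ → R ≗ R′ →
               writeSp s a v ℓ R ≈ₐ writeSp s a′ v′ ℓ R′
writeSp-cong priv ℓ {R} {R′} refl refl R≗ = (refl , λ b → upd-cong R R′ _ _ (R≗ b)) , refl
writeSp-cong shared ℓ refl refl R≗ = (refl , R≗) , refl

procStep-local : ∀ P {S S′ s s′} → s ≈ₚ s′ →
  let a = touched (fetch P (pc s)) (reg s) S in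
  S (proj₁ a) ≡ S′ (proj₁ a) → S (proj₂ a) ≡ S′ (proj₂ a) →
  procStep P S s ≈ₐ procStep P S′ s′
procStep-local P {s = ⟨ ℓ , R ⟩} (refl , R≗) e₁ e₂ with fetch P ℓ
... | nothing   = (refl , R≗) , refl
... | just skip = (refl , R≗) , refl
... | just (const (s , _) c) = writeSp-cong s (suc ℓ) refl refl R≗
... | just (arith o (s , _) (s₁ , i) (s₂ , j)) =
  writeSp-cong s (suc ℓ) refl
    (cong₂ (evalOp o) (readSp-cong s₁ R≗ e₁) (readSp-cong s₂ R≗ e₂)) R≗
... | just (copy (s , _) (s₁ , i)) =
  writeSp-cong s (suc ℓ) refl (readSp-cong s₁ R≗ e₁) R≗
procStep-local P {S} {S′} {s′ = ⟨ _ , R′ ⟩} (refl , R≗) e₁ e₂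
    | just (iread (s , _) s₂ (s₁ , i)) =
  writeSp-cong s (suc _) refl
    -- First the memories change at the address computed from `R` and `S`, the one that `touched`
    -- records; then that address is replaced by the equal one computed from `R′` and `S′`.
    (trans (readSp-cong s₂ R≗ e₂) (cong (readSp s₂ R′ S′) (readSp-cong s₁ R≗ e₁))) R≗
procStep-local P (refl , R≗) e₁ e₂ | just (iwrite s (s₁ , i) (s₂ , j)) =
  writeSp-cong s (suc _) (readSp-cong s₁ R≗ e₁) (readSp-cong s₂ R≗ e₂) R≗
procStep-local P (refl , R≗) e₁ e₂ | just (ifz (s₁ , i) ℓ₁ ℓ₂) =
  (cong (λ z → if does (z ℤ.≟ + 0) then ℓ₁ else ℓ₂) (readSp-cong s₁ R≗ e₁) , R≗) , refl

-- The shared write of one synchronous step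

commit : Maybe (ℤ × ℤ) → Mem → Mem
commit nothing        S = S
commit (just (a , v)) S = upd S a v

commit-cong : ∀ w (S S′ : Mem) {a} → S a ≡ S′ a → commit w S a ≡ commit w S′ a
commit-cong nothing        S S′ eq = eq
commit-cong (just (b , v)) S S′ eq = upd-cong S S′ b v eq

actions : (G : PRAM) → Config (numProcs G) → Fin (numProcs G) → Action
actions G C i = procStep (PRAM.prog G i) (sharedMem C) (procs C i)

written : (G : PRAM) → Config (numProcs G) → Maybe (ℤ × ℤ)
written G C = firstWrite (numProcs G) (actions G C)

sharedMem-step : ∀ G C → sharedMem (step G C) ≡ commit (written G C) (sharedMem C)
sharedMem-step G C with written G C
... | nothing = refl
... | just _  = refl

-- `run` peels off the first step, while the inductions on time below need the last one.
step-run : ∀ G t C → run G (suc t) C ≡ step G (run G t C)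
step-run G zero    C = refl
step-run G (suc t) C = step-run G t (step G C)

-- Only the first writer counts, so fixing the cells it has read fixes the write.
first-writer : ∀ {Y : Set} n (A : Y → Fin n → Action) →
  ¬ ¬ ((∀ y → firstWrite n (A y) ≡ nothing) ⊎
       (∃[ i ] ∃[ y ] ∀ z → write (A z i) ≡ write (A y i) → firstWrite n (A z) ≡ firstWrite n (A y)))
first-writer zero A k = k (inj₁ λ _ → refl)
first-writer {Y} (suc n) A k = ¬¬-excluded-middle {A = ∃[ y ] ∃[ w ] write (A y zero) ≡ just w} λ where
    (yes (y , w , eq)) → k (inj₂ (zero , y , λ z eq′ →
      trans (now z (trans eq′ eq)) (sym (now y eq))))
    (no none) → first-writer n (λ y i → A y (suc i)) λ where
      (inj₁ silent) → k (inj₁ λ y → trans (later none y) (silent y))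
      (inj₂ (i , y , same)) → k (inj₂ (suc i , y , λ z eq →
        trans (later none z) (trans (same z eq) (sym (later none y)))))
  where
  now : ∀ z {w} → write (A z zero) ≡ just w → firstWrite (suc n) (A z) ≡ just w
  now z eq with write (A z zero)
  now z refl | just _ = refl

  later : ¬ (∃[ y ] ∃[ w ] write (A y zero) ≡ just w) →
          ∀ z → firstWrite (suc n) (A z) ≡ firstWrite n (λ i → A z (suc i))
  later none z with write (A z zero) in eq
  ... | just w  = contradiction (z , w , eq) none
  ... | nothing = refl

-- The adversary argument: few input cells determine the run

module Adversary (G : PRAM) {X : Set} (input : X → List ℤ) where

  mem : X → Mem
  mem x = inputMem (input x)

  conf : X → ℕ → Config (numProcs G)
  conf x t = run G t (initConfig G (input x))

  Agree : List ℤ → X → X → Set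
  Agree F x y = All (λ a → mem x a ≡ mem y a) F

  SameHistory : ℕ → X → X → Set
  SameHistory t x y = ∀ t′ → t′ < t → written G (conf x t′) ≡ written G (conf y t′)

  -- An address is recorded even if its cell has been overwritten since the start: agreement is
  -- always about the initial content.
  footprint : X → Fin (numProcs G) → ℕ → List ℤ
  footprint x i zero    = []
  footprint x i (suc t) = proj₁ a ∷ proj₂ a ∷ footprint x i t
    where
    C = conf x t
    s = procs C i
    a = touched (fetch (PRAM.prog G i) (pc s)) (reg s) (sharedMem C)

  length-footprint : ∀ x i t → length (footprint x i t) ≡ t * 2
  length-footprint x i zero    = refl
  length-footprint x i (suc t) = cong (λ l → suc (suc l)) (length-footprint x i t)

  conf-suc : ∀ x t → conf x (suc t) ≡ step G (conf x t)
  conf-suc x t = step-run G t _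

  sharedMem-suc : ∀ x t a →
    sharedMem (conf x (suc t)) a ≡ commit (written G (conf x t)) (sharedMem (conf x t)) a
  sharedMem-suc x t a = cong-app
    (trans (cong sharedMem (conf-suc x t)) (sharedMem-step G (conf x t))) a

  procs-suc : ∀ x t i → procs (conf x (suc t)) i ≡ next (actions G (conf x t) i)
  procs-suc x t i = cong (λ C → procs C i) (conf-suc x t)

  earlier : ∀ {t x y} → SameHistory (suc t) x y → SameHistory t x y
  earlier h t′ t′<t = h t′ (m<n⇒m<1+n t′<t)

  -- A cell holds its initial content unless one of the committed writes hit it, and these writes
  -- are the same in both runs.
  sharedMem-local : ∀ t {x y a} → SameHistory t x y → mem x a ≡ mem y a →
                    sharedMem (conf x t) a ≡ sharedMem (conf y t) a
  sharedMem-local zero    h eq = eq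
  sharedMem-local (suc t) {x} {y} {a} h eq = begin
    sharedMem (conf x (suc t)) a                             ≡⟨ sharedMem-suc x t a ⟩
    commit (written G (conf x t)) (sharedMem (conf x t)) a   ≡⟨ cong (λ w → commit w _ a) (h t ≤-refl) ⟩
    commit (written G (conf y t)) (sharedMem (conf x t)) a   ≡⟨ commit-cong (written G (conf y t)) _ _ (sharedMem-local t (earlier h) eq) ⟩
    commit (written G (conf y t)) (sharedMem (conf y t)) a   ≡⟨ sharedMem-suc y t a ⟨
    sharedMem (conf y (suc t)) a                             ∎
    where open ≡-Reasoning

  -- Mutual induction with `actions-local`. The footprint of `x` alone suffices: as long as the two
  -- runs agree, the processor touches the same cells in both.
  procs-local : ∀ t {x y} i → SameHistory t x y → Agree (footprint x i t) x y →
                procs (conf x t) i ≈ₚ procs (conf y t) i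

  actions-local : ∀ t {x y} i → SameHistory t x y → Agree (footprint x i (suc t)) x y →
                  actions G (conf x t) i ≈ₐ actions G (conf y t) i

  procs-local zero i h agree = refl , λ _ → refl
  procs-local (suc t) {x} {y} i h agree =
    subst₂ _≈ₚ_ (sym (procs-suc x t i)) (sym (procs-suc y t i))
      (_≈ₐ_.next≈ (actions-local t i (earlier h) agree))

  actions-local t {x} {y} i h (e₁ ∷ e₂ ∷ agree) =
    procStep-local (PRAM.prog G i) (procs-local t i h agree)
      (sharedMem-local t {x} {y} h e₁) (sharedMem-local t {x} {y} h e₂)

  -- Step `t` costs 2 (t + 1) new cells, and these costs add up to `t * suc t`. Whether some
  -- compatible input makes a given processor write is not decidable, hence the double negation; it
  -- is harmless because the theorem is itself a negation.
  fix-history : X → ∀ t → ¬ ¬ (∃[ x ] ∃[ F ] length F ≤ t * suc t ×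
                               (∀ y → Agree F x y → SameHistory t x y))
  fix-history x₀ zero k = k (x₀ , [] , z≤n , λ _ _ _ ())
  fix-history x₀ (suc t) k = fix-history x₀ t λ (x , F , F≤ , fixed) →
    -- Only inputs compatible with the cells fixed so far compete for the first writer.
    first-writer {Y = ∃ (Agree F x)} (numProcs G) (λ (y , _) → actions G (conf y t)) λ where
      (inj₁ silent) → k (x , F , ≤-trans F≤ (*-mono-≤ (n≤1+n t) (n≤1+n (suc t))) , λ y agree →
        extend (fixed y agree) (trans (silent (x , All.tabulate λ _ → refl)) (sym (silent (y , agree)))))
      (inj₂ (i , (z , agree-xz) , same)) →
        let R = footprint z i (suc t) in
        k (z , R ++ F , bound z i F≤ , λ y agree →
          -- The reference input moves from `x` to `z`. Since `z` agrees with `x` on `F`, so does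
          -- `y`, and the earlier writes of `y` and `z` are both those of `x`.
          let agree-xy = All.zipWith (λ (p , q) → trans p q) (agree-xz , ++⁻ʳ R agree)
              history  = λ t′ t′<t → trans (sym (fixed z agree-xz t′ t′<t)) (fixed y agree-xy t′ t′<t)
          in extend history (sym (same (y , agree-xy)
               (sym (_≈ₐ_.write≡ (actions-local t i history (++⁻ˡ R agree)))))))
    where
    extend : ∀ {x y} → SameHistory t x y → written G (conf x t) ≡ written G (conf y t) →
             SameHistory (suc t) x y
    extend h eq t′ t′<1+t with m<1+n⇒m<n∨m≡n t′<1+t
    ... | inj₁ t′<t = h t′ t′<t
    ... | inj₂ refl = eq

    bound : ∀ z i {F} → length F ≤ t * suc t →
            length (footprint z i (suc t) ++ F) ≤ suc t * suc (suc t)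
    bound z i {F} F≤ = begin
      length (footprint z i (suc t) ++ F)         ≡⟨ length-++ (footprint z i (suc t)) ⟩
      length (footprint z i (suc t)) + length F   ≡⟨ cong (_+ length F) (length-footprint z i (suc t)) ⟩
      suc t * 2 + length F                        ≤⟨ +-monoʳ-≤ (suc t * 2) F≤ ⟩
      suc t * 2 + t * suc t                       ≡⟨ cong (ℕ._+_ (suc t * 2)) (*-comm t (suc t)) ⟩
      suc t * 2 + suc t * t                       ≡⟨ *-distribˡ-+ (suc t) 2 t ⟨
      suc t * suc (suc t)                         ∎
      where open ≤-Reasoning

  footprint-earlier : ∀ {x i y t T} → t ℕ.≤′ T →
                      Agree (footprint x i T) x y → Agree (footprint x i t) x y
  footprint-earlier ℕ.≤′-refl       agree           = agree
  footprint-earlier (ℕ.≤′-step t≤T) (_ ∷ _ ∷ agree) = footprint-earlier t≤T agree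

  -- Once all writes are fixed, the 2 T cells touched by processor `zero` fix its control states,
  -- and T (T + 1) + 2 T = T (T + 3). Every `t ≤ T` is covered because acceptance may occur at any
  -- of these times.
  fix-acceptance : X → ∀ T → ¬ ¬ (∃[ x ] ∃[ F ] length F ≤ T * (3 + T) ×
    (∀ y → Agree F x y → ∀ t → t ≤ T → pc (procs (conf x t) zero) ≡ pc (procs (conf y t) zero)))
  fix-acceptance x₀ T = ¬¬-map
    (λ (x , F , F≤ , fixed) →
      let R = footprint x zero T in
      x , R ++ F , bound x F≤ , λ y agree t t≤T →
        _≈ₚ_.pc≡ (procs-local t zero
          (λ t′ t′<t → fixed y (++⁻ʳ R agree) t′ (≤-trans t′<t t≤T))
          (footprint-earlier (≤⇒≤′ t≤T) (++⁻ˡ R agree))))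
    (fix-history x₀ T)
    where
    bound : ∀ x {F} → length F ≤ T * suc T → length (footprint x zero T ++ F) ≤ T * (3 + T)
    bound x {F} F≤ = begin
      length (footprint x zero T ++ F)         ≡⟨ length-++ (footprint x zero T) ⟩
      length (footprint x zero T) + length F   ≡⟨ cong (_+ length F) (length-footprint x zero T) ⟩
      T * 2 + length F                         ≤⟨ +-monoʳ-≤ (T * 2) F≤ ⟩
      T * 2 + T * suc T                        ≡⟨ *-distribˡ-+ T 2 (suc T) ⟨
      T * (3 + T)                              ∎
      where open ≤-Reasoning

-- Finite sums and counting

sum-mono-≤ : ∀ {n} {f g : Fin n → ℕ} → (∀ i → f i ≤ g i) → sum f ≤ sum g
sum-mono-≤ {zero}  f≤g = z≤n
sum-mono-≤ {suc n} f≤g = +-mono-≤ (f≤g zero) (sum-mono-≤ (f≤g ∘ suc))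

sum-one : ∀ n → sum {n} (λ _ → 1) ≡ n
sum-one zero    = refl
sum-one (suc n) = cong suc (sum-one n)

bit : Bool → ℕ
bit b = if b then 1 else 0

bit≤1 : ∀ b → bit b ≤ 1
bit≤1 true  = ≤-refl
bit≤1 false = z≤n

bit-∨ : ∀ p q → bit (p ∨ q) ≤ bit p + bit q
bit-∨ true  q = s≤s z≤n
bit-∨ false q = ≤-refl

count-≡ : ∀ {n} (p : Fin n → ℤ) → (∀ {u v} → p u ≡ p v → u ≡ v) →
          ∀ a → sum (λ v → bit (does (p v ℤ.≟ a))) ≤ 1
count-≡ {zero}  p inj a = z≤n
count-≡ {suc n} p inj a with p zero ℤ.≟ a
... | no  _    = count-≡ (p ∘ suc) (λ eq → suc-injective (inj eq)) a
... | yes refl = s≤s (≤-reflexive (trans (sum-cong-≗ miss) (sum-replicate-zero n)))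
  where
  miss : ∀ v → bit (does (p (suc v) ℤ.≟ p zero)) ≡ 0
  miss v = cong bit (dec-false (p (suc v) ℤ.≟ p zero) λ eq → contradiction (inj eq) λ ())

-- A union bound over the entries of `F`: by injectivity each entry accounts for at most one index.
count-∈ : ∀ {n} (p : Fin n → ℤ) → (∀ {u v} → p u ≡ p v → u ≡ v) →
          ∀ F → sum (λ v → bit (does (p v ∈? F))) ≤ length F
count-∈ {n} p inj []      = ≤-reflexive (sum-replicate-zero n)
count-∈     p inj (a ∷ F) = begin
  sum (λ v → bit (does (p v ∈? (a ∷ F))))                            ≤⟨ sum-mono-≤ (λ v → bit-∨ (does (p v ℤ.≟ a)) _) ⟩
  sum (λ v → bit (does (p v ℤ.≟ a)) + bit (does (p v ∈? F)))         ≡⟨ ∑-distrib-+ (λ v → bit (does (p v ℤ.≟ a))) _ ⟩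
  sum (λ v → bit (does (p v ℤ.≟ a))) + sum (λ v → bit (does (p v ∈? F)))  ≤⟨ +-mono-≤ (count-≡ p inj a) (count-∈ p inj F) ⟩
  suc (length F)                                                     ∎
  where open ≤-Reasoning

-- Natural numbers as rationals

fromℕ : ℕ → ℚ
fromℕ a = + a / 1

-- The gcd in `+ a / 1` does not compute for a variable `a`, so the arithmetic below is done on
-- unnormalised fractions.
toℚᵘ-fromℕ : ∀ a → ℚ.toℚᵘ (fromℕ a) ℚᵘ.≃ ℚᵘ.mkℚᵘ (+ a) 0
toℚᵘ-fromℕ a = ℚ.toℚᵘ-fromℚᵘ (ℚᵘ.mkℚᵘ (+ a) 0)

fromℕ-+ : ∀ a b → fromℕ (a + b) ≡ fromℕ a ℚ.+ fromℕ b
fromℕ-+ a b = ℚ.toℚᵘ-injective (begin-equality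
  ℚ.toℚᵘ (fromℕ (a + b))                              ≃⟨ toℚᵘ-fromℕ (a + b) ⟩
  ℚᵘ.mkℚᵘ (+ (a + b)) 0                                ≃⟨ ℚᵘ.*≡* (cong (ℤ._* + 1) (cong₂ ℤ._+_ (ℤ.*-identityʳ (+ a)) (ℤ.*-identityʳ (+ b)))) ⟨
  ℚᵘ.mkℚᵘ (+ a) 0 ℚᵘ.+ ℚᵘ.mkℚᵘ (+ b) 0                  ≃⟨ ℚᵘ.+-cong (toℚᵘ-fromℕ a) (toℚᵘ-fromℕ b) ⟨
  ℚ.toℚᵘ (fromℕ a) ℚᵘ.+ ℚ.toℚᵘ (fromℕ b)                ≃⟨ ℚ.toℚᵘ-homo-+ (fromℕ a) (fromℕ b) ⟨
  ℚ.toℚᵘ (fromℕ a ℚ.+ fromℕ b)                         ∎)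
  where open ℚᵘ.≤-Reasoning

fromℕ-mono-≤ : ∀ {a b} → a ≤ b → fromℕ a ℚ.≤ fromℕ b
fromℕ-mono-≤ {a} {b} a≤b = ℚ.toℚᵘ-cancel-≤ (begin
  ℚ.toℚᵘ (fromℕ a)   ≃⟨ toℚᵘ-fromℕ a ⟩
  ℚᵘ.mkℚᵘ (+ a) 0     ≤⟨ ℚᵘ.*≤* (ℤ.*-monoʳ-≤-nonNeg (+ 1) (ℤ.+≤+ a≤b)) ⟩
  ℚᵘ.mkℚᵘ (+ b) 0     ≃⟨ toℚᵘ-fromℕ b ⟨
  ℚ.toℚᵘ (fromℕ b)   ∎)
  where open ℚᵘ.≤-Reasoning

fromℕ-cancel-≤ : ∀ {a b} → fromℕ a ℚ.≤ fromℕ b → a ≤ b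
fromℕ-cancel-≤ {a} {b} a≤b = ℤ.drop‿+≤+ (ℤ.*-cancelʳ-≤-pos (+ a) (+ b) (+ 1) (ℚᵘ.drop-*≤* (begin
  ℚᵘ.mkℚᵘ (+ a) 0     ≃⟨ toℚᵘ-fromℕ a ⟨
  ℚ.toℚᵘ (fromℕ a)   ≤⟨ ℚ.toℚᵘ-mono-≤ a≤b ⟩
  ℚ.toℚᵘ (fromℕ b)   ≃⟨ toℚᵘ-fromℕ b ⟩
  ℚᵘ.mkℚᵘ (+ b) 0     ∎)))
  where open ℚᵘ.≤-Reasoning

sumℚ-fromℕ : ∀ n (f : Fin n → ℕ) → sumℚ n (fromℕ ∘ f) ≡ fromℕ (sum f)
sumℚ-fromℕ zero    f = refl
sumℚ-fromℕ (suc n) f = trans (cong (ℚ._+_ (fromℕ (f zero))) (sumℚ-fromℕ n (f ∘ suc)))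
                             (sym (fromℕ-+ (f zero) (sum (f ∘ suc))))

sumℚ-mono-≤ : ∀ n {f g : Fin n → ℚ} → (∀ i → f i ℚ.≤ g i) → sumℚ n f ℚ.≤ sumℚ n g
sumℚ-mono-≤ zero    f≤g = ℚ.≤-refl
sumℚ-mono-≤ (suc n) f≤g = ℚ.+-mono-≤ (f≤g zero) (sumℚ-mono-≤ n (f≤g ∘ suc))

-- Contents and length of an encoded input

inputMem-tabulate : ∀ {n} (f g : Fin n → ℤ) zs i → (∀ v → toℕ v ≡ i → f v ≡ g v) →
  inputMem (tabulate f ++ zs) +[1+ i ] ≡ inputMem (tabulate g ++ zs) +[1+ i ]
inputMem-tabulate {zero}  f g zs i       f≡g = refl
inputMem-tabulate {suc n} f g zs zero    f≡g = f≡g zero refl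
inputMem-tabulate {suc n} f g zs (suc i) f≡g =
  inputMem-tabulate (f ∘ suc) (g ∘ suc) zs i (λ v eq → f≡g (suc v) (cong suc eq))

entryLength : ℤ → ℕ
entryLength z = 2 + bitLen ℤ.∣ z ∣

inputLength-++ : ∀ xs ys → inputLength (xs ++ ys) ≡ inputLength xs + inputLength ys
inputLength-++ xs ys = trans (cong sumᴸ (map-++ entryLength xs ys)) (sum-++ (map entryLength xs) _)

-- Capacities 0 and 1 have codes of equal length, so all star networks of one size are given to the
-- same machine of the family.
entryLength-bit : ∀ b → entryLength (+ bit b) ≡ 3
entryLength-bit true  = refl
entryLength-bit false = refl

inputLength-tabulate : ∀ {n} (f : Fin n → ℤ) → (∀ v → entryLength (f v) ≡ 3) →
                       inputLength (tabulate f) ≡ n * 3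
inputLength-tabulate {zero}  f eq = refl
inputLength-tabulate {suc n} f eq = cong₂ _+_ (eq zero) (inputLength-tabulate (f ∘ suc) (eq ∘ suc))

inputLength-concat : ∀ {n} (f : Fin n → List ℤ) l → (∀ u → inputLength (f u) ≡ l) →
                     inputLength (concat (tabulate f)) ≡ n * l
inputLength-concat {zero}  f l eq = refl
inputLength-concat {suc n} f l eq = trans (inputLength-++ (f zero) _)
  (cong₂ _+_ (eq zero) (inputLength-concat (f ∘ suc) l (eq ∘ suc)))

-- Star networks

module Star (M k : ℕ) where

  -- The capacity rows below that of the source, the same for all inputs: row `zero` belongs to the
  -- sink, the others to the middle vertices, each with an edge of capacity 1 to the sink.
  fixedCap : Fin (suc M) → Fin (2 + M) → ℕ
  fixedCap (suc _) (suc zero) = 1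
  fixedCap _       _          = 0

  cap : (Fin M → Bool) → Fin (2 + M) → Fin (2 + M) → ℕ
  cap x zero (suc (suc v)) = bit (x v)
  cap x zero _             = 0
  cap x (suc u) v          = fixedCap u v

  network : (Fin M → Bool) → MaxflowInstance
  network x = record { n = 2 + M ; s = zero ; t = suc zero ; cap = cap x ; k = + k }

  Σbit : (Fin M → Bool) → ℕ
  Σbit x = sum (bit ∘ x)

  flow : (Fin M → Bool) → Fin (2 + M) → Fin (2 + M) → ℕ
  flow x zero          (suc (suc v)) = bit (x v)
  flow x (suc (suc v)) (suc zero)    = bit (x v)
  flow x _             _             = 0

  flow≤cap : ∀ x u v → flow x u v ≤ cap x u v
  flow≤cap x zero          zero          = z≤n
  flow≤cap x zero          (suc zero)    = z≤n
  flow≤cap x zero          (suc (suc v)) = ≤-refl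
  flow≤cap x (suc zero)    v             = z≤n
  flow≤cap x (suc (suc u)) zero          = z≤n
  flow≤cap x (suc (suc u)) (suc zero)    = bit≤1 (x u)
  flow≤cap x (suc (suc u)) (suc (suc v)) = z≤n

  maxflow-yes : ∀ x → k ≤ Σbit x → MaxflowYes (network x)
  maxflow-yes x k≤ = f , isFlow , (begin
      fromℕ k                                              ≤⟨ fromℕ-mono-≤ k≤ ⟩
      fromℕ (Σbit x)                                       ≡⟨ ℚ.+-identityʳ _ ⟨
      fromℕ (Σbit x) ℚ.- fromℕ 0                           ≡⟨ cong (λ a → fromℕ (Σbit x) ℚ.- fromℕ a) (sum-replicate-zero M) ⟨
      fromℕ (Σbit x) ℚ.- fromℕ (sum {M} (λ _ → 0))         ≡⟨ cong₂ ℚ._-_ (sumℚ-fromℕ _ (flow x zero)) (sumℚ-fromℕ _ (λ u → flow x u zero)) ⟨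
      flowValue (network x) f                              ∎)
    where
    open ℚ.≤-Reasoning
    f : Fin (2 + M) → Fin (2 + M) → ℚ
    f u v = fromℕ (flow x u v)

    conserve : ∀ v → ¬ (v ≡ zero) → ¬ (v ≡ suc zero) →
               inflow (network x) f v ≡ outflow (network x) f v
    conserve zero          ≢s ≢t = contradiction refl ≢s
    conserve (suc zero)    ≢s ≢t = contradiction refl ≢t
    conserve (suc (suc v)) ≢s ≢t =
      -- Both sums compute to `bit (x v)` plus a sum of zeros.
      trans (sumℚ-fromℕ _ (λ u → flow x u (suc (suc v)))) (sym (sumℚ-fromℕ _ (flow x (suc (suc v)))))

    isFlow : IsFlow (network x) f
    isFlow = record
      { nonneg   = λ u v → fromℕ-mono-≤ {0} {flow x u v} z≤n
      ; capacity = λ u v → fromℕ-mono-≤ (flow≤cap x u v)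
      ; conserve = conserve
      }

  -- The cut that separates the source from all other vertices has capacity `Σbit x`.
  maxflow-bound : ∀ x → MaxflowYes (network x) → k ≤ Σbit x
  maxflow-bound x (f , isFlow , k≤) = fromℕ-cancel-≤ (begin
      fromℕ k                                    ≤⟨ k≤ ⟩
      outflow (network x) f zero ℚ.- inflow (network x) f zero
        ≤⟨ ℚ.+-mono-≤ (sumℚ-mono-≤ _ (capacity zero)) (ℚ.neg-antimono-≤ 0≤inflow) ⟩
      sumℚ (2 + M) (fromℕ ∘ cap x zero) ℚ.- 0ℚ    ≡⟨ ℚ.+-identityʳ _ ⟩
      sumℚ (2 + M) (fromℕ ∘ cap x zero)          ≡⟨ sumℚ-fromℕ _ (cap x zero) ⟩
      fromℕ (Σbit x)                             ∎)
    where
    open ℚ.≤-Reasoning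
    open IsFlow isFlow
    0≤inflow : 0ℚ ℚ.≤ inflow (network x) f zero
    0≤inflow = begin
      0ℚ                                 ≡⟨ cong fromℕ (sum-replicate-zero M) ⟨
      fromℕ (sum {2 + M} (λ _ → 0))      ≡⟨ sumℚ-fromℕ (2 + M) (λ _ → 0) ⟨
      sumℚ (2 + M) (λ _ → 0ℚ)            ≤⟨ sumℚ-mono-≤ (2 + M) (λ u → nonneg u zero) ⟩
      inflow (network x) f zero          ∎

  bits : (Fin M → Bool) → List ℤ
  bits x = tabulate (λ v → + bit (x v))

  fixedRows : List ℤ
  fixedRows = concat (tabulate (λ u → tabulate (λ v → + fixedCap u v)))

  -- Isolates the variable block. The two zeros before it are the capacities from the source to
  -- itself and to the sink.
  encode-network : ∀ x → encode (network x) ≡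
    + (2 + M) ∷ + 0 ∷ + 1 ∷ + k ∷ + 0 ∷ + 0 ∷ bits x ++ fixedRows
  encode-network x = cong₂ (λ xs ys → + (2 + M) ∷ + 0 ∷ + 1 ∷ + k ∷ + 0 ∷ + 0 ∷ xs ++ concat ys)
    (map-tabulate (λ v → suc (suc v)) (λ v → + cap x zero v))
    (trans (map-tabulate suc (λ u → map (λ v → + cap x u v) (allFin (2 + M))))
           (tabulate-cong (λ u → map-tabulate (λ v → v) (λ v → + fixedCap u v))))

  -- Register 0 holds the length, registers 1–6 the six entries before the bits.
  address : Fin M → ℤ
  address v = + (7 + toℕ v)

  address-injective : ∀ {u v} → address u ≡ address v → u ≡ v
  address-injective eq = toℕ-injective (+-cancelˡ-≡ 7 _ _ (ℤ.+-injective eq))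

  length-bits : ∀ x → length (bits x ++ fixedRows) ≡ M + length fixedRows
  length-bits x = trans (length-++ (bits x)) (cong (_+ length fixedRows) (length-tabulate _))

  inputMem-local : ∀ x y a → (∀ v → address v ≡ a → x v ≡ y v) →
                   inputMem (encode (network x)) a ≡ inputMem (encode (network y)) a
  inputMem-local x y a x≡y rewrite encode-network x | encode-network y = go a x≡y
    where
    go : ∀ a → (∀ v → address v ≡ a → x v ≡ y v) →
         inputMem (+ (2 + M) ∷ + 0 ∷ + 1 ∷ + k ∷ + 0 ∷ + 0 ∷ bits x ++ fixedRows) a ≡
         inputMem (+ (2 + M) ∷ + 0 ∷ + 1 ∷ + k ∷ + 0 ∷ + 0 ∷ bits y ++ fixedRows) a
    go (+ 0) _ = cong (λ l → + (6 + l)) (trans (length-bits x) (sym (length-bits y)))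
    go (+ 1) _ = refl
    go (+ 2) _ = refl
    go (+ 3) _ = refl
    go (+ 4) _ = refl
    go (+ 5) _ = refl
    go (+ 6) _ = refl
    go +[1+ suc (suc (suc (suc (suc (suc i))))) ] eq =
      inputMem-tabulate _ _ fixedRows i (λ v v≡i → cong (λ b → + bit b) (eq v (cong (λ j → + (7 + j)) v≡i)))
    go -[1+ _ ] _ = refl

  entryLength-fixedCap : ∀ u v → entryLength (+ fixedCap u v) ≡ 3
  entryLength-fixedCap zero    v             = refl
  entryLength-fixedCap (suc u) zero          = refl
  entryLength-fixedCap (suc u) (suc zero)    = refl
  entryLength-fixedCap (suc u) (suc (suc v)) = refl

  -- The first 6 counts the entries for source and sink, the second the two zeros before the bits;
  -- every capacity takes 3.
  networkLength : ℕ
  networkLength = entryLength (+ (2 + M)) + (6 + (entryLength (+ k) + (6 + (M * 3 + suc M * ((2 + M) * 3)))))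

  inputLength-network : ∀ x → inputLength (encode (network x)) ≡ networkLength
  inputLength-network x = trans (cong inputLength (encode-network x))
    (cong (λ l → entryLength (+ (2 + M)) + (6 + (entryLength (+ k) + (6 + l))))
      (trans (inputLength-++ (bits x) fixedRows)
        (cong₂ _+_ (inputLength-tabulate _ (entryLength-bit ∘ x))
                   (inputLength-concat (λ u → tabulate (λ v → + fixedCap u v)) ((2 + M) * 3)
                     (λ u → inputLength-tabulate (λ v → + fixedCap u v) (entryLength-fixedCap u))))))

-- Growth estimates

n<2^n : ∀ n → n < 2 ^ n
n<2^n zero    = s≤s z≤n
n<2^n (suc n) = begin-strict
  suc n              ≤⟨ n<2^n n ⟩
  2 ^ n              <⟨ m<m+n (2 ^ n) (≤-trans (m^n>0 2 n) (m≤m+n (2 ^ n) 0)) ⟩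
  2 ^ suc n          ∎
  where open ≤-Reasoning

⌊log₂n⌋≤n : ∀ n → ⌊log₂ n ⌋ ≤ n
⌊log₂n⌋≤n n = subst (⌊log₂ n ⌋ ≤_) (⌊log₂[2^n]⌋≡n n) (⌊log₂⌋-mono-≤ (<⇒≤ (n<2^n n)))

-- With `h` at least E, 2 D and L, the linear function at 2 h is at most (h + 1) h, and the factors
-- are at most `2 ^ h`, the second strictly below it.
linear<2^ : ∀ E D L → ∃[ i ] (L ≤ i × E + D * i < 2 ^ i)
linear<2^ E D L = h + h , ≤-trans (m≤n+m L (E + (D + D))) (m≤m+n h h) , (begin-strict
  E + D * (h + h)        ≡⟨ cong (ℕ._+_ E) (trans (*-distribˡ-+ D h h) (sym (*-distribʳ-+ h D D))) ⟩
  E + (D + D) * h        ≤⟨ +-mono-≤ (≤-trans (m≤m+n E (D + D)) (m≤m+n _ L))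
                                     (*-monoˡ-≤ h (≤-trans (m≤n+m (D + D) E) (m≤m+n _ L))) ⟩
  suc h * h              <⟨ *-monoʳ-< (suc h) (n<2^n h) ⟩
  suc h * 2 ^ h          ≤⟨ *-monoˡ-≤ (2 ^ h) (n<2^n h) ⟩
  2 ^ h * 2 ^ h          ≡⟨ ^-distribˡ-+-* 2 h h ⟨
  2 ^ (h + h)            ∎)
  where
  open ≤-Reasoning
  h = E + (D + D) + L

open Star using (networkLength)

-- With k = p + 1 the difference of the two sides has nonnegative coefficients, so the inequality
-- becomes an identity without subtraction.
polynomial-slack : ∀ p → let k = suc p in
  3 + (2 + (k + k)) + (6 + (3 + k + (6 + ((k + k) * 3 + suc (k + k) * ((2 + (k + k)) * 3))))) +
    (116 * (p * p) + 205 * p + 63) ≡ 128 * (k * k)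
polynomial-slack = solve-∀

networkLength-≤ : ∀ k .{{_ : NonZero k}} → networkLength (k + k) k ≤ 128 * (k * k)
networkLength-≤ k@(suc p) = begin
  networkLength (k + k) k   ≤⟨ +-mono-≤ (+-monoʳ-≤ 3 (⌊log₂n⌋≤n (2 + (k + k))))
                                 (+-monoʳ-≤ 6 (+-monoˡ-≤ _ (+-monoʳ-≤ 3 (⌊log₂n⌋≤n k)))) ⟩
  3 + (2 + (k + k)) + (6 + (3 + k + (6 + ((k + k) * 3 + suc (k + k) * ((2 + (k + k)) * 3)))))
                            ≤⟨ m≤m+n _ _ ⟩
  3 + (2 + (k + k)) + (6 + (3 + k + (6 + ((k + k) * 3 + suc (k + k) * ((2 + (k + k)) * 3))))) +
    (116 * (p * p) + 205 * p + 63)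
                            ≡⟨ polynomial-slack p ⟩
  128 * (k * k)             ∎
  where open ≤-Reasoning

≤-networkLength : ∀ k → k ≤ networkLength (k + k) k
≤-networkLength k = begin
  k                   ≤⟨ m≤m+n k k ⟩
  k + k               ≤⟨ m≤m*n (k + k) 3 ⟩
  (k + k) * 3         ≤⟨ m≤m+n _ _ ⟩
  (k + k) * 3 + _     ≤⟨ m≤n+m _ (3 + ⌊log₂ k ⌋ + 6) ⟩
  3 + ⌊log₂ k ⌋ + 6 + _    ≡⟨ +-assoc (3 + ⌊log₂ k ⌋) 6 _ ⟩
  3 + ⌊log₂ k ⌋ + (6 + _)  ≤⟨ m≤n+m _ (3 + ⌊log₂ 2 + (k + k) ⌋ + 6) ⟩
  3 + ⌊log₂ 2 + (k + k) ⌋ + 6 + _    ≡⟨ +-assoc (3 + ⌊log₂ 2 + (k + k) ⌋) 6 _ ⟩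
  networkLength (k + k) k  ∎
  where open ≤-Reasoning

log-networkLength : ∀ j → ⌊log₂ networkLength (2 ^ j + 2 ^ j) (2 ^ j) ⌋ ≤ 7 + (j + j)
log-networkLength j = begin
  ⌊log₂ networkLength (k + k) k ⌋   ≤⟨ ⌊log₂⌋-mono-≤ (networkLength-≤ k) ⟩
  ⌊log₂ 128 * (k * k) ⌋             ≡⟨ cong (λ a → ⌊log₂ 128 * a ⌋) (^-distribˡ-+-* 2 j j) ⟨
  ⌊log₂ 2 ^ 7 * 2 ^ (j + j) ⌋       ≡⟨ cong ⌊log₂_⌋ (^-distribˡ-+-* 2 7 (j + j)) ⟨
  ⌊log₂ 2 ^ (7 + (j + j)) ⌋         ≡⟨ ⌊log₂[2^n]⌋≡n (7 + (j + j)) ⟩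
  7 + (j + j)                       ∎
  where
  open ≤-Reasoning
  k = 2 ^ j
  instance k≢0 = m^n≢0 2 j

-- The double exponential choice of `k` makes the logarithm of the length at most `2 ^ (4 + i)`, so
-- the time bound is a power of 2 whose exponent is linear in `i`.
step-bound : ∀ b c i → let j = 2 ^ i ; k = 2 ^ j in
  b * logPow c (networkLength (k + k) k) ≤ 2 ^ (b + (4 + i) * c)
step-bound b c i = begin
  b * ⌊log₂ networkLength (k + k) k ⌋ ^ c   ≤⟨ *-mono-≤ (<⇒≤ (n<2^n b)) (^-monoˡ-≤ c (≤-trans (log-networkLength j) 7+2j≤)) ⟩
  2 ^ b * (2 ^ (4 + i)) ^ c                 ≡⟨ cong (2 ^ b *_) (^-*-assoc 2 (4 + i) c) ⟩
  2 ^ b * 2 ^ ((4 + i) * c)                 ≡⟨ ^-distribˡ-+-* 2 b ((4 + i) * c) ⟨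
  2 ^ (b + (4 + i) * c)                     ∎
  where
  open ≤-Reasoning
  j = 2 ^ i
  k = 2 ^ j
  7+2j≤ : 7 + (j + j) ≤ 2 ^ (4 + i)
  7+2j≤ = begin
    7 + (j + j)              ≤⟨ +-monoˡ-≤ (j + j) (*-monoʳ-≤ 7 (m^n>0 2 i)) ⟩
    -- Rounds 9 j up to 16 j, a power of 2 times j.
    7 * j + (j + j)          ≤⟨ m≤m+n _ (7 * j) ⟩
    7 * j + (j + j) + 7 * j  ≡⟨ regroup j ⟩
    2 ^ 4 * j                ≡⟨ ^-distribˡ-+-* 2 4 i ⟨
    2 ^ (4 + i)              ∎
    where
    regroup : ∀ a → 7 * a + (a + a) + 7 * a ≡ 2 ^ 4 * a
    regroup = solve-∀

T[3+T]≤ : ∀ {T} e → T ≤ 2 ^ e → T * (3 + T) ≤ 2 ^ (e + (e + 2))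
T[3+T]≤ {T} e T≤ = begin
  T * (3 + T)              ≤⟨ *-mono-≤ T≤ (+-mono-≤ (*-monoʳ-≤ 3 (m^n>0 2 e)) T≤) ⟩
  2 ^ e * (3 * 2 ^ e + 2 ^ e)   ≡⟨ cong (2 ^ e *_) (regroup (2 ^ e)) ⟩
  2 ^ e * (2 ^ e * 2 ^ 2)  ≡⟨ cong (2 ^ e *_) (^-distribˡ-+-* 2 e 2) ⟨
  2 ^ e * 2 ^ (e + 2)      ≡⟨ ^-distribˡ-+-* 2 e (e + 2) ⟨
  2 ^ (e + (e + 2))        ∎
  where
  open ≤-Reasoning
  regroup : ∀ a → 3 * a + a ≡ a * 2 ^ 2
  regroup = solve-∀

-- For `k = 2 ^ (2 ^ i)` it suffices that `2 ^ i` exceeds an exponent linear in `i`.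
large-network : ∀ b c N₁ → ∃[ k ] let N = networkLength (k + k) k ; T = b * logPow c N in
                N₁ ≤ N × T * (3 + T) < k
large-network b c N₁ with linear<2^ (2 + 8 * c + 2 * b) (2 * c) N₁
... | i , N₁≤i , <2^i = k , N₁≤N , (begin-strict
  T * (3 + T)                          ≤⟨ T[3+T]≤ (b + (4 + i) * c) (step-bound b c i) ⟩
  2 ^ (e + (e + 2))                    ≡⟨ cong (2 ^_) (regroup b c i) ⟩
  2 ^ (2 + 8 * c + 2 * b + 2 * c * i)  <⟨ ^-monoʳ-< 2 (s≤s (s≤s z≤n)) <2^i ⟩
  k                                    ∎)
  where
  open ≤-Reasoning
  k = 2 ^ (2 ^ i)
  N = networkLength (k + k) k
  T = b * logPow c N
  e = b + (4 + i) * c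
  regroup : ∀ b c i → b + (4 + i) * c + (b + (4 + i) * c + 2) ≡ 2 + 8 * c + 2 * b + 2 * c * i
  regroup = solve-∀
  N₁≤N : N₁ ≤ N
  N₁≤N = begin
    N₁     ≤⟨ N₁≤i ⟩
    i      <⟨ n<2^n i ⟩
    2 ^ i  <⟨ n<2^n (2 ^ i) ⟩
    k      ≤⟨ ≤-networkLength k ⟩
    N      ∎

-- Two indistinguishable networks with different answers

module Refutation (c : ℕ) (G : ℕ → PRAM) (b N₁ k : ℕ) where

  open Star (k + k) k hiding (networkLength)

  N T : ℕ
  N = networkLength (k + k) k
  T = b * logPow c N

  open Adversary (G N) (λ x → encode (network x))

  -- The length is a parameter, so that `inputLength-network` can replace it in the machine and the
  -- time bound at once.
  Correct : ℕ → MaxflowInstance → Set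
  Correct N I = N₁ ≤ N →
    (MaxflowYes I → AcceptsWithin (G N) (b * logPow c N) (encode I)) ×
    (AcceptsWithin (G N) (b * logPow c N) (encode I) → MaxflowYes I)

  module _ (x : Fin (k + k) → Bool) (F : List ℤ) where

    fill : Bool → Fin (k + k) → Bool
    fill d v = if does (address v ∈? F) then x v else d

    hit : Fin (k + k) → ℕ
    hit v = bit (does (address v ∈? F))

    hits≤ : sum hit ≤ length F
    hits≤ = count-∈ address address-injective F

    fill-agree : ∀ d → Agree F x (fill d)
    fill-agree d = All.tabulate λ {a} a∈F → inputMem-local x (fill d) a λ where
      v refl → cong (λ q → if q then x v else d) (sym (dec-true (address v ∈? F) a∈F))

    fill-false≤ : Σbit (fill false) ≤ length F
    fill-false≤ = ≤-trans (sum-mono-≤ pointwise) hits≤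
      where
      pointwise : ∀ v → bit (fill false v) ≤ hit v
      pointwise v with does (address v ∈? F)
      ... | true  = bit≤1 (x v)
      ... | false = z≤n

    -- Additive form of Σ ≥ 2 k - |F|: an index counts as a 1 if it is free and as a hit if it is
    -- fixed.
    ≤fill-true : k + k ≤ Σbit (fill true) + length F
    ≤fill-true = begin
      k + k                                          ≡⟨ sum-one (k + k) ⟨
      sum {k + k} (λ _ → 1)                          ≤⟨ sum-mono-≤ pointwise ⟩
      sum (λ v → bit (fill true v) + hit v)          ≡⟨ ∑-distrib-+ (λ v → bit (fill true v)) hit ⟩
      Σbit (fill true) + sum hit                     ≤⟨ +-monoʳ-≤ (Σbit (fill true)) hits≤ ⟩
      Σbit (fill true) + length F                    ∎
      where
      open ≤-Reasoning
      pointwise : ∀ v → 1 ≤ bit (fill true v) + hit v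
      pointwise v with does (address v ∈? F)
      ... | true  = m≤n+m 1 (bit (x v))
      ... | false = ≤-refl

  refutation : T * (3 + T) < k → N₁ ≤ N →
               ¬ (∀ I → Correct (inputLength (encode I)) I)
  refutation T[3+T]<k N₁≤N decides =
    -- The starting input is arbitrary. From the result, `y` gets at least 2 k - |F| ≥ k ones and
    -- `z` at most |F| < k.
    fix-acceptance (λ _ → false) T λ (x , F , F≤ , fixed) → let
      open ≤-Reasoning
      y = fill x F true
      z = fill x F false

      k≤Σy : k ≤ Σbit y
      k≤Σy = +-cancelʳ-≤ k k _ (≤-trans (≤fill-true x F)
        (+-monoʳ-≤ (Σbit y) (≤-trans F≤ (<⇒≤ T[3+T]<k))))

      (t , t≤T , accepted) = proj₁ (correct y) (maxflow-yes y k≤Σy)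

      -- Acceptance passes from `y` through `x` to `z` at the same time `t`.
      accepted′ = trans (sym (fixed z (fill-agree x F false) t t≤T))
                        (trans (fixed y (fill-agree x F true) t t≤T) accepted)
      in <⇒≱ T[3+T]<k (begin
        k            ≤⟨ maxflow-bound z (proj₂ (correct z) (t , t≤T , accepted′)) ⟩
        Σbit z       ≤⟨ fill-false≤ x F ⟩
        length F     ≤⟨ F≤ ⟩
        T * (3 + T)  ∎)
    where
    correct : ∀ x → (MaxflowYes (network x) → AcceptsWithin (G N) T (encode (network x))) ×
                    (AcceptsWithin (G N) T (encode (network x)) → MaxflowYes (network x))
    correct x = subst (λ l → Correct l (network x)) (inputLength-network x) (decides (network x)) N₁≤N

theorem63 : (c : ℕ) → 1 ≤ c → (G : ℕ → PRAM) →
    ProcessorBound c G → ¬ DecidesMaxflowPolylog c G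
theorem63 c 1≤c G _ (b , N₁ , decides) =
  let (k , N₁≤N , T[3+T]<k) = large-network b c N₁
  in Refutation.refutation c G b N₁ k T[3+T]<k N₁≤N decides
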